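{- Let $n$ be a positive integer and let $a,b$ be integers with $0\le a,b\le n$. Then there exists an orientation of the $n$-cube $Q_n$ in which every vertex has in-degree equal to $a$ or to $b$ if and only if there exist non-negative integers $s$ and $t$ such that $s+t=2^n$ and $as+bt=n2^{n-1}$.
   Context: The $n$-cube $Q_n$ is the graph whose vertices are the binary $n$-tuples, two vertices being adjacent iff they differ in exactly one coordinate. An orientation assigns to each edge a head and a tail; the in-degree of a vertex is the number of edges whose head is that vertex. -}

module Defs where

open import Data.Bool using (Bool; true; false)
open import Data.List using (List; []; _∷_; _++_; map; filter; length)
open import Data.Nat using (ℕ; zero; suc)
open import Data.Product using (∃!)
open import Data.Sum using (_⊎_)
open import Data.Vec as Vec using (Vec; lookup)
open import Level using (0ℓ)
open import Relation.Binary using (Rel; Decidable; Asymmetric; _⇒_)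
open import Relation.Binary.PropositionalEquality using (_≡_; _≢_)

Vertex : ℕ → Set
Vertex n = Vec Bool n

Adjacent : ∀ {n} → Rel (Vertex n) 0ℓ
Adjacent u v = ∃! _≡_ λ i → lookup u i ≢ lookup v i

vertices : ∀ n → List (Vertex n)
vertices zero    = Vec.[] ∷ []
vertices (suc n) = map (false Vec.∷_) (vertices n) ++ map (true Vec.∷_) (vertices n)

-- `u ⟶ v` says that {u , v} is an edge of the n-cube with tail u and head v.
-- Decidability is what allows the edges with a given head to be counted.
record Orientation (n : ℕ) : Set₁ where
  infix 4 _⟶_ _⟶?_
  field
    _⟶_      : Rel (Vertex n) 0ℓ
    _⟶?_     : Decidable _⟶_
    adjacent : _⟶_ ⇒ Adjacent
    oriented : ∀ {u v} → Adjacent u v → u ⟶ v ⊎ v ⟶ u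
    asym     : Asymmetric _⟶_

  -- An edge with head v is determined by its tail, so it is the tails that
  -- are counted.
  inDegree : Vertex n → ℕ
  inDegree v = length (filter (_⟶? v) (vertices n))

open Orientation public using (inDegree)

{-# OPTIONS --safe #-}
-- Necessity: the in-degrees sum to the number n 2^(n-1) of edges.
--
-- Sufficiency: say a ≤ b, and put d = b - a, e = |a + b - n|.  The numerical
-- condition forces d ∣ 2^(n-1) e, hence d = g 2^j and e = g α with α ≤ 2^j.
-- After reversing all edges if necessary, n = 2r + gα + g 2^j, a = r + gα and
-- b = a + g 2^j.  Split the directions of the cube into r "up" directions,
-- r + gα "down" directions, and g directions for each colour c in F₂^j; let the
-- colour of a vertex v be the sum of the colours of the directions i with
-- vᵢ = 1.  Fix a set A of α colours.  An edge joins an even to an odd vertex: it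
-- leaves the odd one if its direction is up, enters it if its direction is down,
-- and otherwise leaves it exactly if the odd vertex has its colour in A.  Odd
-- vertices then have in-degree r + gα or r + gα + g 2^j.  At an even vertex the
-- neighbours in coloured directions have every colour g times, so exactly r + gα
-- edges come in.
module Submission where

open import Data.Bool using (Bool; true; false; not; if_then_else_; _xor_)
open import Data.Bool.Properties as Bool using (not-involutive; not-¬; ¬-not; xor-assoc; xor-comm; xor-same)
open import Data.Empty using (⊥-elim)
open import Data.Fin using (Fin; zero; suc)
open import Data.Fin.Properties using (any?; _≟_)
open import Data.List using (List; []; _∷_; _++_; map; length; filter; replicate; concat; tabulate; allFin; lookup)
open import Data.List.Properties using (map-++; map-∘; map-cong; map-tabulate; tabulate-lookup; length-tabulate; length-++; length-map)
open import Data.Nat using (ℕ; zero; suc; _+_; _*_; _^_; _∸_; _⊓_; _≤_; s≤s)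
open import Data.Nat.Divisibility using (_∣_; divides; ∣m+n∣m⇒∣n; m∣m*n; n∣m*n; *-cancelʳ-∣)
open import Data.Nat.ListAction using (sum)
open import Data.Nat.ListAction.Properties using (sum-++)
open import Data.Nat.Properties hiding (_≟_)
open import Data.Nat.Tactic.RingSolver using (solve-∀)
open import Data.Product using (_×_; _,_; proj₁; proj₂; Σ-syntax; ∃-syntax)
open import Data.Sum as Sum using (_⊎_; inj₁; inj₂)
open import Data.Vec as Vec using (updateAt)
open import Data.Vec.Properties as Vec using (lookup∘updateAt; lookup∘updateAt′; updateAt-updateAt; updateAt-id-local; zipWith-assoc; zipWith-comm)
open import Level using (0ℓ)
open import Function using (_∘_; flip; const)
open import Function.Bundles using (_⇔_; mk⇔)
open import Relation.Binary.PropositionalEquality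
open import Relation.Nullary using (yes; no; does; ¬_; _×-dec_)
open import Relation.Nullary.Decidable using (dec-true; dec-false)
open import Relation.Unary using (Pred; Decidable)
open import Defs

open Orientation using (_⟶_; _⟶?_; adjacent; oriented; asym)
open ≡-Reasoning

private variable
  A B : Set
  n : ℕ

-- Finite sums

∑ : List A → (A → ℕ) → ℕ
∑ xs f = sum (map f xs)

∑-cong : ∀ (xs : List A) {f g : A → ℕ} → f ≗ g → ∑ xs f ≡ ∑ xs g
∑-cong xs f≗g = cong sum (map-cong f≗g xs)

∑-++ : ∀ (xs ys : List A) f → ∑ (xs ++ ys) f ≡ ∑ xs f + ∑ ys f
∑-++ xs ys f = trans (cong sum (map-++ f xs ys)) (sum-++ (map f xs) (map f ys))

∑-map : ∀ (h : A → B) xs f → ∑ (map h xs) f ≡ ∑ xs (f ∘ h)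
∑-map h xs f = cong sum (sym (map-∘ xs))

∑-const : ∀ (xs : List A) k → ∑ xs (const k) ≡ length xs * k
∑-const []       k = refl
∑-const (_ ∷ xs) k = cong (k +_) (∑-const xs k)

∑-0 : ∀ (xs : List A) {f} → (∀ x → f x ≡ 0) → ∑ xs f ≡ 0
∑-0 xs f≡0 = trans (∑-cong xs f≡0) (trans (∑-const xs 0) (*-zeroʳ (length xs)))

∑-replicate : ∀ k (x : A) f → ∑ (replicate k x) f ≡ k * f x
∑-replicate zero    x f = refl
∑-replicate (suc k) x f = cong (f x +_) (∑-replicate k x f)

∑-concat-replicate : ∀ k (xs : List A) f → ∑ (concat (replicate k xs)) f ≡ k * ∑ xs f
∑-concat-replicate zero    xs f = refl
∑-concat-replicate (suc k) xs f =
  trans (∑-++ xs (concat (replicate k xs)) f) (cong (∑ xs f +_) (∑-concat-replicate k xs f))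

∑-+ : ∀ (xs : List A) f g → ∑ xs (λ x → f x + g x) ≡ ∑ xs f + ∑ xs g
∑-+ []       f g = refl
∑-+ (x ∷ xs) f g = trans (cong (f x + g x +_) (∑-+ xs f g)) (interchange (f x) (g x) _ _)
  where
  interchange : ∀ p q r s → p + q + (r + s) ≡ p + r + (q + s)
  interchange = solve-∀

∑-swap : ∀ (xs : List A) (ys : List B) (f : A → B → ℕ) →
         ∑ xs (λ x → ∑ ys (f x)) ≡ ∑ ys (λ y → ∑ xs (flip f y))
∑-swap []       ys f = sym (∑-0 ys (λ _ → refl))
∑-swap (x ∷ xs) ys f =
  trans (cong (∑ ys (f x) +_) (∑-swap xs ys f)) (sym (∑-+ ys (f x) _))

∑-lookup : ∀ (xs : List A) f → ∑ (allFin (length xs)) (f ∘ lookup xs) ≡ ∑ xs f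
∑-lookup xs f = cong sum (begin
  map (f ∘ lookup xs) (allFin (length xs)) ≡⟨ map-tabulate _ (f ∘ lookup xs) ⟩
  tabulate (f ∘ lookup xs)                 ≡⟨ map-tabulate (lookup xs) f ⟨
  map f (tabulate (lookup xs))             ≡⟨ cong (map f) (tabulate-lookup xs) ⟩
  map f xs                                 ∎)

⟦_⟧ : Bool → ℕ
⟦ b ⟧ = if b then 1 else 0

length-filter≡∑ : ∀ {P : Pred A 0ℓ} (P? : Decidable P) xs → length (filter P? xs) ≡ ∑ xs (λ x → ⟦ does (P? x) ⟧)
length-filter≡∑ P? [] = refl
length-filter≡∑ P? (x ∷ xs) with does (P? x)
... | true  = cong suc (length-filter≡∑ P? xs)
... | false = length-filter≡∑ P? xs

-- Vertices and edges of the cube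

length-vertices : ∀ n → length (vertices n) ≡ 2 ^ n
length-vertices zero    = refl
length-vertices (suc n) = begin
  length (map (false Vec.∷_) (vertices n) ++ map (true Vec.∷_) (vertices n))
    ≡⟨ length-++ (map (false Vec.∷_) (vertices n)) ⟩
  length (map (false Vec.∷_) (vertices n)) + length (map (true Vec.∷_) (vertices n))
    ≡⟨ cong₂ _+_ (length-map _ (vertices n)) (length-map _ (vertices n)) ⟩
  length (vertices n) + length (vertices n)
    ≡⟨ cong₂ _+_ (length-vertices n) (trans (length-vertices n) (sym (+-identityʳ _))) ⟩
  2 ^ suc n ∎

∑-vertices-suc : ∀ n (f : Vertex (suc n) → ℕ) →
  ∑ (vertices (suc n)) f ≡ ∑ (vertices n) (f ∘ (false Vec.∷_)) + ∑ (vertices n) (f ∘ (true Vec.∷_))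
∑-vertices-suc n f = trans (∑-++ (map (false Vec.∷_) (vertices n)) _ f)
  (cong₂ _+_ (∑-map _ (vertices n) f) (∑-map _ (vertices n) f))

∑-vertices-split : ∀ n x (f : Vertex (suc n) → ℕ) →
  ∑ (vertices (suc n)) f ≡ ∑ (vertices n) (f ∘ (not x Vec.∷_)) + ∑ (vertices n) (f ∘ (x Vec.∷_))
∑-vertices-split n true  f = ∑-vertices-suc n f
∑-vertices-split n false f = trans (∑-vertices-suc n f) (+-comm (∑ (vertices n) (f ∘ (false Vec.∷_))) _)

flipAt : Fin n → Vertex n → Vertex n
flipAt i v = updateAt v i not

flipAt-involutive : ∀ (i : Fin n) v → flipAt i (flipAt i v) ≡ v
flipAt-involutive i v =
  trans (updateAt-updateAt i v) (updateAt-id-local i v (not-involutive _))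

not≢ : ∀ x → not x ≢ x
not≢ true  ()
not≢ false ()

flipAt-adjacent : ∀ (i : Fin n) v → Adjacent (flipAt i v) v
flipAt-adjacent i v = i , (λ eq → not≢ _ (trans (sym (lookup∘updateAt i v)) eq)) , unique _
  where
  unique : ∀ j → Vec.lookup (flipAt i v) j ≢ Vec.lookup v j → i ≡ j
  unique j differ with i ≟ j
  ... | yes i≡j = i≡j
  ... | no  i≢j = ⊥-elim (differ (lookup∘updateAt′ j i (i≢j ∘ sym) v))

flipAt-injectiveˡ : ∀ {i j : Fin n} v → flipAt i v ≡ flipAt j v → i ≡ j
flipAt-injectiveˡ {i = i} {j} v eq =
  proj₂ (proj₂ (flipAt-adjacent i v))
    (subst (λ u → Vec.lookup u j ≢ Vec.lookup v j) (sym eq) (proj₁ (proj₂ (flipAt-adjacent j v))))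

lookup-extensional : ∀ {u v : Vertex n} → (∀ i → Vec.lookup u i ≡ Vec.lookup v i) → u ≡ v
lookup-extensional {u = Vec.[]}    {Vec.[]}    eq = refl
lookup-extensional {u = _ Vec.∷ _} {_ Vec.∷ _} eq = cong₂ Vec._∷_ (eq zero) (lookup-extensional (eq ∘ suc))

adjacent⇒flipAt : ∀ {u v : Vertex n} → Adjacent u v → ∃[ i ] u ≡ flipAt i v
adjacent⇒flipAt {u = u} {v} (i , differ , unique) = i , lookup-extensional agree
  where
  agree : ∀ j → Vec.lookup u j ≡ Vec.lookup (flipAt i v) j
  agree j with i ≟ j
  ... | yes refl = trans (¬-not differ) (sym (lookup∘updateAt i v))
  ... | no  i≢j  with Vec.lookup u j Bool.≟ Vec.lookup v j
  ...   | yes same = trans same (sym (lookup∘updateAt′ j i (i≢j ∘ sym) v))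
  ...   | no  diff = ⊥-elim (i≢j (unique diff))

∑-only : ∀ (f : Vertex n → ℕ) v → (∀ u → u ≢ v → f u ≡ 0) → ∑ (vertices n) f ≡ f v
∑-only {zero}  f Vec.[]      f≡0 = +-identityʳ _
∑-only {suc n} f (x Vec.∷ v) f≡0 = begin
  ∑ (vertices (suc n)) f                                        ≡⟨ ∑-vertices-split n x f ⟩
  ∑ (vertices n) (f ∘ (not x Vec.∷_)) + ∑ (vertices n) (f ∘ (x Vec.∷_))
    ≡⟨ cong₂ _+_ (∑-0 (vertices n) (λ u → f≡0 _ (not≢ x ∘ cong Vec.head)))
                 (∑-only (f ∘ (x Vec.∷_)) v (λ u u≢v → f≡0 _ (u≢v ∘ cong Vec.tail))) ⟩
  f (x Vec.∷ v) ∎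

-- Induction on the dimension: in the half cube not containing `v` only the neighbour across the
-- first coordinate contributes, and the other half is the induction hypothesis. This turns a count
-- of tails over all vertices into a sum over directions.
∑-neighbours : ∀ (f : Vertex n → ℕ) v → (∀ u → (∀ i → u ≢ flipAt i v) → f u ≡ 0) →
               ∑ (vertices n) f ≡ ∑ (allFin n) (λ i → f (flipAt i v))
∑-neighbours {zero}  f Vec.[]      f≡0 = trans (+-identityʳ _) (f≡0 Vec.[] λ ())
∑-neighbours {suc n} f (x Vec.∷ v) f≡0 = begin
  ∑ (vertices (suc n)) f ≡⟨ ∑-vertices-split n x f ⟩
  ∑ (vertices n) (f ∘ (not x Vec.∷_)) + ∑ (vertices n) (f ∘ (x Vec.∷_))
    ≡⟨ cong₂ _+_
         (∑-only (f ∘ (not x Vec.∷_)) v λ u u≢v → f≡0 _ λ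
            { zero → u≢v ∘ cong Vec.tail
            ; (suc i) → not≢ x ∘ cong Vec.head })
         (∑-neighbours (f ∘ (x Vec.∷_)) v λ u u≢flips → f≡0 _ λ
            { zero → not≢ x ∘ sym ∘ cong Vec.head
            ; (suc i) → u≢flips i ∘ cong Vec.tail }) ⟩
  f (not x Vec.∷ v) + ∑ (allFin n) (λ i → f (x Vec.∷ flipAt i v))
    ≡⟨ cong (λ xs → f (not x Vec.∷ v) + sum xs)
         (trans (map-tabulate {n = n} _ _) (sym (map-tabulate suc _))) ⟩
  ∑ (allFin (suc n)) (λ i → f (flipAt i (x Vec.∷ v))) ∎

-- In-degrees

reverse : Orientation n → Orientation n
reverse o = record
  { _⟶_      = flip (_⟶_ o)
  ; _⟶?_     = flip (_⟶?_ o)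
  ; adjacent = λ {u} {v} v⟶u → symmetric {v} {u} (adjacent o v⟶u)
  ; oriented = λ {u} {v} adj → Sum.swap (oriented o {u} {v} adj)
  ; asym     = asym o
  }
  where
  symmetric : ∀ {u v : Vertex _} → Adjacent u v → Adjacent v u
  symmetric (i , differ , unique) = i , ≢-sym differ , unique ∘ ≢-sym

module _ (o : Orientation n) where

  arc : Vertex n → Vertex n → ℕ
  arc u v = ⟦ does (_⟶?_ o u v) ⟧

  inDegree≡∑ : ∀ v → inDegree o v ≡ ∑ (vertices n) (λ u → arc u v)
  inDegree≡∑ v = length-filter≡∑ (λ u → _⟶?_ o u v) (vertices n)

  inDegree≡∑-flipAt : ∀ v → inDegree o v ≡ ∑ (allFin n) (λ i → arc (flipAt i v) v)
  inDegree≡∑-flipAt v = trans (inDegree≡∑ v) (∑-neighbours (λ u → arc u v) v λ u u≢flips →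
    cong ⟦_⟧ (dec-false (_⟶?_ o u v) λ u⟶v →
      let i , u≡flip = adjacent⇒flipAt (adjacent o u⟶v) in u≢flips i u≡flip))

  arc+arc : ∀ {u v} → Adjacent u v → arc u v + arc v u ≡ 1
  arc+arc {u} {v} adj with oriented o adj
  ... | inj₁ u⟶v = cong₂ (λ p q → ⟦ p ⟧ + ⟦ q ⟧) (dec-true (_⟶?_ o u v) u⟶v) (dec-false (_⟶?_ o v u) (asym o u⟶v))
  ... | inj₂ v⟶u = cong₂ (λ p q → ⟦ p ⟧ + ⟦ q ⟧) (dec-false (_⟶?_ o u v) (asym o v⟶u)) (dec-true (_⟶?_ o v u) v⟶u)

-- The second summand is the out-degree of `v`, and each of the `n` edges at `v` is counted exactly
-- once.
inDegree-reverse : ∀ (o : Orientation n) v → inDegree o v + inDegree (reverse o) v ≡ n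
inDegree-reverse {n} o v = begin
  inDegree o v + inDegree (reverse o) v
    ≡⟨ cong₂ _+_ (inDegree≡∑-flipAt o v) (inDegree≡∑-flipAt (reverse o) v) ⟩
  ∑ (allFin n) (λ i → arc o (flipAt i v) v) + ∑ (allFin n) (λ i → arc o v (flipAt i v))
    ≡⟨ ∑-+ (allFin n) _ _ ⟨
  ∑ (allFin n) (λ i → arc o (flipAt i v) v + arc o v (flipAt i v))
    ≡⟨ ∑-cong (allFin n) (λ i → arc+arc o (flipAt-adjacent i v)) ⟩
  ∑ (allFin n) (const 1) ≡⟨ ∑-const (allFin n) 1 ⟩
  length (allFin n) * 1  ≡⟨ *-identityʳ _ ⟩
  length (allFin n)      ≡⟨ length-tabulate {n = n} _ ⟩
  n                      ∎

∑-inDegree-reverse : ∀ (o : Orientation n) →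
  ∑ (vertices n) (inDegree o) ≡ ∑ (vertices n) (inDegree (reverse o))
∑-inDegree-reverse {n} o = begin
  ∑ (vertices n) (inDegree o)                              ≡⟨ ∑-cong (vertices n) (inDegree≡∑ o) ⟩
  ∑ (vertices n) (λ v → ∑ (vertices n) (λ u → arc o u v)) ≡⟨ ∑-swap (vertices n) (vertices n) _ ⟩
  ∑ (vertices n) (λ u → ∑ (vertices n) (λ v → arc o u v)) ≡⟨ ∑-cong (vertices n) (inDegree≡∑ (reverse o)) ⟨
  ∑ (vertices n) (inDegree (reverse o))                    ∎

-- In-degrees and out-degrees have the same total, as both count all arcs; together they give the
-- degree sum, so the total is half of that.
∑-inDegree : ∀ {m} (o : Orientation (suc m)) → ∑ (vertices (suc m)) (inDegree o) ≡ suc m * 2 ^ m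
∑-inDegree {m} o = *-cancelˡ-≡ _ _ 2 (begin
  2 * D                                  ≡⟨ cong (D +_) (+-identityʳ D) ⟩
  D + D                                  ≡⟨ cong (D +_) (∑-inDegree-reverse o) ⟩
  D + ∑ V (inDegree (reverse o))         ≡⟨ ∑-+ V _ _ ⟨
  ∑ V (λ v → inDegree o v + inDegree (reverse o) v) ≡⟨ ∑-cong V (inDegree-reverse o) ⟩
  ∑ V (const (suc m))                    ≡⟨ ∑-const V (suc m) ⟩
  length V * suc m                       ≡⟨ cong (_* suc m) (length-vertices (suc m)) ⟩
  2 * 2 ^ m * suc m                      ≡⟨ *-assoc 2 (2 ^ m) (suc m) ⟩
  2 * (2 ^ m * suc m)                    ≡⟨ cong (2 *_) (*-comm (2 ^ m) (suc m)) ⟩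
  2 * (suc m * 2 ^ m)                    ∎)
  where
  V = vertices (suc m)
  D = ∑ V (inDegree o)

∑-two-valued : ∀ (xs : List A) (f : A → ℕ) {a b} → (∀ x → f x ≡ a ⊎ f x ≡ b) →
  ∃[ s ] ∃[ t ] (s + t ≡ length xs × a * s + b * t ≡ ∑ xs f)
∑-two-valued []       f {a} {b} _ = 0 , 0 , refl , cong₂ _+_ (*-zeroʳ a) (*-zeroʳ b)
∑-two-valued (x ∷ xs) f {a} {b} two with ∑-two-valued xs f two | two x
... | s , t , s+t , as+bt | inj₁ fx≡a = suc s , t , cong suc s+t , (begin
    a * suc s + b * t   ≡⟨ cong (_+ b * t) (*-suc a s) ⟩
    a + a * s + b * t   ≡⟨ +-assoc a (a * s) (b * t) ⟩
    a + (a * s + b * t) ≡⟨ cong₂ _+_ (sym fx≡a) as+bt ⟩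
    f x + ∑ xs f        ∎)
... | s , t , s+t , as+bt | inj₂ fx≡b = s , suc t , trans (+-suc s t) (cong suc s+t) , (begin
    a * s + b * suc t   ≡⟨ rearrange a b s t ⟩
    b + (a * s + b * t) ≡⟨ cong₂ _+_ (sym fx≡b) as+bt ⟩
    f x + ∑ xs f        ∎)
  where
  rearrange : ∀ a b s t → a * s + b * suc t ≡ b + (a * s + b * t)
  rearrange = solve-∀

-- Orientations from a choice of heads

-- `head i v` tells whether the edge in direction `i` at `v` enters `v`. The hypothesis makes the
-- two ends of an edge disagree, so that each edge gets exactly one head.
module _ (head : Fin n → Vertex n → Bool)
         (head-flipAt : ∀ i v → head i (flipAt i v) ≡ not (head i v)) where

  orientation : Orientation n
  orientation = record
    { _⟶_      = λ u v → ∃[ i ] (u ≡ flipAt i v × head i v ≡ true)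
    ; _⟶?_     = λ u v → any? λ i → Vec.≡-dec Bool._≟_ u (flipAt i v) ×-dec (head i v Bool.≟ true)
    ; adjacent = λ { {_} {v} (i , refl , _) → flipAt-adjacent i v }
    ; oriented = λ adj → orient (adjacent⇒flipAt adj)
    ; asym     = λ { {_} {v} (i , refl , hd) (j , v≡flip , hd′) → antisymmetric v i j hd v≡flip hd′ }
    }
    where
    orient : ∀ {u v : Vertex n} → ∃[ i ] u ≡ flipAt i v →
             ∃[ i ] (u ≡ flipAt i v × head i v ≡ true) ⊎ ∃[ i ] (v ≡ flipAt i u × head i u ≡ true)
    orient {v = v} (i , refl) with head i v in eq
    ... | true  = inj₁ (i , refl , eq)
    ... | false = inj₂ (i , sym (flipAt-involutive i v) , trans (head-flipAt i v) (cong not eq))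

    antisymmetric : ∀ v i j → head i v ≡ true → v ≡ flipAt j (flipAt i v) → ¬ head j (flipAt i v) ≡ true
    antisymmetric v i j hd v≡flip hd′
      -- Both arcs lie in the same direction, so both ends of one edge would claim to be its head.
      with refl ← flipAt-injectiveˡ (flipAt i v) (trans (flipAt-involutive i v) v≡flip)
      with () ← trans (sym hd′) (trans (head-flipAt i v) (cong not hd))

  inDegree-orientation : ∀ v → inDegree orientation v ≡ ∑ (allFin n) (λ i → ⟦ head i v ⟧)
  inDegree-orientation v =
    trans (inDegree≡∑-flipAt orientation v) (∑-cong (allFin n) (cong ⟦_⟧ ∘ agree))
    where
    agree : ∀ i → does (_⟶?_ orientation (flipAt i v) v) ≡ head i v
    agree i with head i v in eq
    ... | true  = dec-true (_⟶?_ orientation (flipAt i v) v) (i , refl , eq)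
    ... | false = dec-false (_⟶?_ orientation (flipAt i v) v) λ
      (j , same , hd) → not-¬ (trans (cong (λ k → head k v) (flipAt-injectiveˡ v same)) hd) eq

-- The group F₂^k

infixr 6 _⊕_
_⊕_ : Vertex n → Vertex n → Vertex n
_⊕_ = Vec.zipWith _xor_

⊕-cancelˡ : ∀ (u v : Vertex n) → u ⊕ (u ⊕ v) ≡ v
⊕-cancelˡ Vec.[]      Vec.[]      = refl
⊕-cancelˡ (x Vec.∷ u) (y Vec.∷ v) =
  cong₂ Vec._∷_ (trans (sym (xor-assoc x x y)) (cong (_xor y) (xor-same x))) (⊕-cancelˡ u v)

⊕-swap : ∀ (u v w : Vertex n) → u ⊕ (v ⊕ w) ≡ v ⊕ (u ⊕ w)
⊕-swap u v w = begin
  u ⊕ (v ⊕ w) ≡⟨ zipWith-assoc xor-assoc u v w ⟨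
  (u ⊕ v) ⊕ w ≡⟨ cong (_⊕ w) (zipWith-comm xor-comm u v) ⟩
  (v ⊕ u) ⊕ w ≡⟨ zipWith-assoc xor-assoc v u w ⟩
  v ⊕ (u ⊕ w) ∎

∑-translate : ∀ (f : Vertex n → ℕ) w → ∑ (vertices n) (λ u → f (u ⊕ w)) ≡ ∑ (vertices n) f
∑-translate {zero}  f Vec.[]      = refl
∑-translate {suc n} f (x Vec.∷ w) = begin
  ∑ (vertices (suc n)) (λ u → f (u ⊕ (x Vec.∷ w)))
    ≡⟨ ∑-vertices-suc n _ ⟩
  ∑ (vertices n) (λ u → f (x Vec.∷ u ⊕ w)) + ∑ (vertices n) (λ u → f (not x Vec.∷ u ⊕ w))
    -- The first bit `x` of the translation sends the `false` half to the half of `x` and the `true`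
    -- half to that of `not x`; within each half the rest is a translation by `w`.
    ≡⟨ cong₂ _+_ (∑-translate (f ∘ (x Vec.∷_)) w) (∑-translate (f ∘ (not x Vec.∷_)) w) ⟩
  ∑ (vertices n) (f ∘ (x Vec.∷_)) + ∑ (vertices n) (f ∘ (not x Vec.∷_))
    ≡⟨ +-comm (∑ (vertices n) (f ∘ (x Vec.∷_))) _ ⟩
  ∑ (vertices n) (f ∘ (not x Vec.∷_)) + ∑ (vertices n) (f ∘ (x Vec.∷_))
    ≡⟨ ∑-vertices-split n x f ⟨
  ∑ (vertices (suc n)) f ∎

-- The `false` half is filled first; once it is full, the remaining elements come from the `true`
-- half.
subset-of-size : ∀ k {α} → α ≤ 2 ^ k → Σ[ p ∈ (Vertex k → Bool) ] ∑ (vertices k) (λ u → ⟦ p u ⟧) ≡ α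
subset-of-size zero    {zero}        _ = const false , refl
subset-of-size zero    {suc zero}    _ = const true , refl
subset-of-size zero    {suc (suc _)} (s≤s ())
subset-of-size (suc k) {α} α≤ with ≤-total α (2 ^ k)
... | inj₁ α≤half with p , size ← subset-of-size k α≤half =
  (λ { (false Vec.∷ u) → p u ; (true Vec.∷ u) → false }) , (begin
    _     ≡⟨ ∑-vertices-suc k _ ⟩
    _     ≡⟨ cong₂ _+_ size (∑-0 (vertices k) (λ _ → refl)) ⟩
    α + 0 ≡⟨ +-identityʳ α ⟩
    α     ∎)
... | inj₂ half≤α
  with p , size ← subset-of-size k {α ∸ 2 ^ k}
    (m≤n+o⇒m∸n≤o α (2 ^ k) (subst (α ≤_) (cong (2 ^ k +_) (+-identityʳ _)) α≤)) =
  (λ { (false Vec.∷ u) → true ; (true Vec.∷ u) → p u }) , (begin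
    _     ≡⟨ ∑-vertices-suc k _ ⟩
    _     ≡⟨ cong₂ _+_ (∑-const (vertices k) 1) size ⟩
    length (vertices k) * 1 + (α ∸ 2 ^ k) ≡⟨ cong (_+ (α ∸ 2 ^ k)) (trans (*-identityʳ _) (length-vertices k)) ⟩
    2 ^ k + (α ∸ 2 ^ k) ≡⟨ m+[n∸m]≡n half≤α ⟩
    α ∎)

-- The linear map over F₂ that sends the i-th basis vector to `label i`.
potential : ∀ {k} → (Fin n → Vertex k) → Vertex n → Vertex k
potential label Vec.[]          = Vec.replicate _ false
potential label (false Vec.∷ v) = potential (label ∘ suc) v
potential label (true Vec.∷ v)  = label zero ⊕ potential (label ∘ suc) v

potential-flipAt : ∀ {k} (label : Fin n → Vertex k) i v →
                   potential label (flipAt i v) ≡ label i ⊕ potential label v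
potential-flipAt label zero    (false Vec.∷ v) = refl
potential-flipAt label zero    (true Vec.∷ v)  = sym (⊕-cancelˡ (label zero) _)
potential-flipAt label (suc i) (false Vec.∷ v) = potential-flipAt (label ∘ suc) i v
potential-flipAt label (suc i) (true Vec.∷ v)  =
  trans (cong (label zero ⊕_) (potential-flipAt (label ∘ suc) i v)) (⊕-swap (label zero) (label (suc i)) _)

-- The construction

TwoInDegrees : ℕ → ℕ → ℕ → Set₁
TwoInDegrees n a b = Σ[ o ∈ Orientation n ] ((v : Vertex n) → inDegree o v ≡ a ⊎ inDegree o v ≡ b)

data Direction (j : ℕ) : Set where
  up down  : Direction j
  coloured : Vertex j → Direction j

module _ {j : ℕ} (p : Vertex j → Bool) where

  -- The first bit of a potential is the parity of the vertex, the others are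
  -- its colour.
  label : Direction j → Vertex (suc j)
  label up           = true Vec.∷ Vec.replicate j false
  label down         = true Vec.∷ Vec.replicate j false
  label (coloured c) = true Vec.∷ c

  -- The second argument is the potential of the end that the edge may enter.
  enters : Direction j → Vertex (suc j) → Bool
  enters up           (odd Vec.∷ x)   = not odd
  enters down         (odd Vec.∷ x)   = odd
  enters (coloured c) (true Vec.∷ x)  = not (p x)
  -- The odd end of this edge has colour `c ⊕ x`, and its membership in A decides.
  enters (coloured c) (false Vec.∷ x) = p (c ⊕ x)

  -- Every label has first bit `true`, so crossing an edge changes the parity. In a coloured
  -- direction both ends consult `p` at the colour of the odd end, with opposite answers.
  enters-label : ∀ d z → enters d (label d ⊕ z) ≡ not (enters d z)
  enters-label up           (odd Vec.∷ x)   = refl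
  enters-label down         (odd Vec.∷ x)   = refl
  enters-label (coloured c) (true Vec.∷ x)  = trans (cong p (⊕-cancelˡ c x)) (sym (not-involutive (p x)))
  enters-label (coloured c) (false Vec.∷ x) = refl

  module _ (ds : List (Direction j)) where

    directionLabel : Fin (length ds) → Vertex (suc j)
    directionLabel = label ∘ lookup ds

    isHead : Fin (length ds) → Vertex (length ds) → Bool
    isHead i v = enters (lookup ds i) (potential directionLabel v)

    isHead-flipAt : ∀ i v → isHead i (flipAt i v) ≡ not (isHead i v)
    isHead-flipAt i v =
      trans (cong (enters (lookup ds i)) (potential-flipAt directionLabel i v)) (enters-label (lookup ds i) _)

    directedCube : Orientation (length ds)
    directedCube = orientation isHead isHead-flipAt

    inDegree-directedCube : ∀ v →
      inDegree directedCube v ≡ ∑ ds (λ d → ⟦ enters d (potential directionLabel v) ⟧)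
    inDegree-directedCube v = trans (inDegree-orientation isHead isHead-flipAt v) (∑-lookup ds _)

-- The parameter `h` stands for the product gα, which keeps the counting independent of the choice
-- of A.
directions : ∀ r h g j → List (Direction j)
directions r h g j =
  replicate r up ++ replicate (r + h) down ++ concat (replicate g (map coloured (vertices j)))

∑-directions : ∀ r h g j f → ∑ (directions r h g j) f ≡
  r * f up + ((r + h) * f down + g * ∑ (vertices j) (f ∘ coloured))
∑-directions r h g j f = begin
  _ ≡⟨ ∑-++ (replicate r up) _ f ⟩
  _ ≡⟨ cong₂ _+_ (∑-replicate r up f) (∑-++ (replicate (r + h) down) _ f) ⟩
  _ ≡⟨ cong (r * f up +_) (cong₂ _+_ (∑-replicate (r + h) down f)
         (trans (∑-concat-replicate g _ f) (cong (g *_) (∑-map coloured (vertices j) f)))) ⟩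
  _ ∎

construction : ∀ r g j {α} → α ≤ 2 ^ j →
  TwoInDegrees (r + (r + g * α) + g * 2 ^ j) (r + g * α) (r + g * α + g * 2 ^ j)
construction r g j {α} α≤ with p , size ← subset-of-size j α≤ =
  subst (λ n → TwoInDegrees n (r + g * α) (r + g * α + g * 2 ^ j)) dimension
    (directedCube p ds , λ v →
       Sum.map (trans (inDegree-directedCube p ds v)) (trans (inDegree-directedCube p ds v)) (degree _))
  where
  ds = directions r (g * α) g j

  ∑-const-vertices : ∀ k → ∑ (vertices j) (const k) ≡ 2 ^ j * k
  ∑-const-vertices k = trans (∑-const (vertices j) k) (cong (_* k) (length-vertices j))

  arith : ∀ r h g N → r * 1 + ((r + h) * 1 + g * (N * 1)) ≡ r + (r + h) + g * N
  arith = solve-∀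

  dimension : length ds ≡ r + (r + g * α) + g * 2 ^ j
  dimension = begin
    length ds       ≡⟨ *-identityʳ _ ⟨
    length ds * 1   ≡⟨ ∑-const ds 1 ⟨
    ∑ ds (const 1)  ≡⟨ ∑-directions r (g * α) g j (const 1) ⟩
    _               ≡⟨ cong (λ k → r * 1 + ((r + g * α) * 1 + g * k)) (∑-const-vertices 1) ⟩
    _               ≡⟨ arith r (g * α) g (2 ^ j) ⟩
    _               ∎

  even-arith : ∀ r h k → r * 1 + ((r + h) * 0 + k) ≡ r + k
  even-arith = solve-∀

  odd-arith₀ : ∀ r h g N → r * 0 + ((r + h) * 1 + g * (N * 0)) ≡ r + h
  odd-arith₀ = solve-∀

  odd-arith₁ : ∀ r h g N → r * 0 + ((r + h) * 1 + g * (N * 1)) ≡ r + h + g * N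
  odd-arith₁ = solve-∀

  degree : ∀ z → ∑ ds (λ d → ⟦ enters p d z ⟧) ≡ r + g * α ⊎ ∑ ds (λ d → ⟦ enters p d z ⟧) ≡ r + g * α + g * 2 ^ j
  degree (false Vec.∷ x) = inj₁ (begin
    _ ≡⟨ ∑-directions r (g * α) g j _ ⟩
    _ ≡⟨ even-arith r (g * α) _ ⟩
    -- As `c` runs over all colours, so does `c ⊕ x`; exactly `α` of them lie in A.
    r + g * ∑ (vertices j) (λ c → ⟦ p (c ⊕ x) ⟧) ≡⟨ cong (λ k → r + g * k) (trans (∑-translate (⟦_⟧ ∘ p) x) size) ⟩
    r + g * α ∎)
  -- At an odd vertex the answer is the same for all coloured directions: none or all of these g 2^j
  -- edges enter.
  degree (true Vec.∷ x) with not (p x) in eq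
  ... | false = inj₁ (trans (∑-directions r (g * α) g j _) (begin
    _ ≡⟨ cong (λ k → r * 0 + ((r + g * α) * 1 + g * k)) (trans (∑-cong (vertices j) (λ _ → cong ⟦_⟧ eq)) (∑-const-vertices 0)) ⟩
    _ ≡⟨ odd-arith₀ r (g * α) g (2 ^ j) ⟩
    _ ∎))
  ... | true  = inj₂ (trans (∑-directions r (g * α) g j _) (begin
    _ ≡⟨ cong (λ k → r * 0 + ((r + g * α) * 1 + g * k)) (trans (∑-cong (vertices j) (λ _ → cong ⟦_⟧ eq)) (∑-const-vertices 1)) ⟩
    _ ≡⟨ odd-arith₁ r (g * α) g (2 ^ j) ⟩
    _ ∎))

-- Arithmetic of the numerical condition

halve : ∀ n → ∃[ k ] (n ≡ k * 2 ⊎ n ≡ suc (k * 2))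
halve zero    = 0 , inj₁ refl
halve (suc n) with halve n
... | k , inj₁ eq = k , inj₂ (cong suc eq)
... | k , inj₂ eq = suc k , inj₁ (cong suc eq)

-- e = e (2k + 1) - k (2e).
odd-∣-*2 : ∀ k {e} → suc (k * 2) ∣ e * 2 → suc (k * 2) ∣ e
odd-∣-*2 k {e} (divides q 2e≡) = ∣m+n∣m⇒∣n (divides e (expand k e))
  (divides (k * q) (trans (cong (k *_) 2e≡) (sym (*-assoc k q _))))
  where
  expand : ∀ k e → k * (e * 2) + e ≡ e * suc (k * 2)
  expand = solve-∀

-- Induction on `m`, moving one factor 2 over to `e`. The resulting `g` divides 2e: an even `g`
-- passes its factor 2 to the power `2 ^ j`, an odd one divides `e` already.
∣2^*⇒ : ∀ m {d e} → d ∣ 2 ^ m * e → ∃[ g ] ∃[ j ] (d ≡ g * 2 ^ j × g ∣ e)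
∣2^*⇒ zero    {d} {e} d∣ = d , 0 , sym (*-identityʳ d) , subst (d ∣_) (*-identityˡ e) d∣
∣2^*⇒ (suc m) {d} {e} d∣ with ∣2^*⇒ m {d} {e * 2} (subst (d ∣_) (rearrange (2 ^ m) e) d∣)
  where
  rearrange : ∀ x e → 2 * x * e ≡ x * (e * 2)
  rearrange = solve-∀
... | g , j , d≡ , g∣2e with halve g
...   | k , inj₁ refl = k , suc j , trans d≡ (*-assoc k 2 (2 ^ j)) , *-cancelʳ-∣ 2 g∣2e
...   | k , inj₂ refl = g , j , d≡ , odd-∣-*2 k g∣2e

common-scale : ∀ m {d e} q → 2 ^ m * d ≡ d * q + 2 ^ m * e →
  ∃[ g ] ∃[ j ] ∃[ α ] (d ≡ g * 2 ^ j × e ≡ g * α × α ≤ 2 ^ j)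
common-scale m {d} {e} q eq
  with ∣2^*⇒ m {d} {e} (∣m+n∣m⇒∣n (subst (d ∣_) eq (n∣m*n (2 ^ m))) (m∣m*n q))
-- If `g` is positive, `e ≤ d` already gives `β ≤ 2 ^ j`. If `g` is 0, then `d` and `e` are 0 and
-- `β` is arbitrary; the minimum covers both cases at once.
... | g , j , d≡ , divides β e≡ = g , j , β ⊓ 2 ^ j , d≡ , sym (begin
    g * (β ⊓ 2 ^ j)       ≡⟨ *-distribˡ-⊓ g β (2 ^ j) ⟩
    (g * β) ⊓ (g * 2 ^ j) ≡⟨ cong₂ _⊓_ (trans (*-comm g β) (sym e≡)) (sym d≡) ⟩
    e ⊓ d                 ≡⟨ m≤n⇒m⊓n≡m e≤d ⟩
    e                     ∎) , m⊓n≤n β (2 ^ j)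
  where
  e≤d : e ≤ d
  e≤d = *-cancelˡ-≤ (2 ^ m) {{m^n≢0 2 m}} (subst (2 ^ m * e ≤_) (sym eq) (m≤n+m _ (d * q)))

-- Reduction to the construction: a + b above or below n

TwoInDegrees-swap : ∀ {a b} → TwoInDegrees n a b → TwoInDegrees n b a
TwoInDegrees-swap (o , two) = o , Sum.swap ∘ two

TwoInDegrees-reverse : ∀ {a b a′ b′} → a + a′ ≡ n → b + b′ ≡ n → TwoInDegrees n a b → TwoInDegrees n a′ b′
TwoInDegrees-reverse a+a′ b+b′ (o , two) = reverse o , λ v →
  Sum.map (complement v a+a′) (complement v b+b′) (two v)
  where
  complement : ∀ v {c c′} → c + c′ ≡ _ → inDegree o v ≡ c → inDegree (reverse o) v ≡ c′
  complement v {c} c+c′ refl = +-cancelˡ-≡ c _ _ (trans (inDegree-reverse o v) (sym c+c′))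

-- Eliminating `s` gives dt = (n - 2a)X, and n - 2a = d - e. Adding `n * X` to both sides avoids
-- subtraction.
scale-equation-above : ∀ n a d {s t X e} → s + t ≡ 2 * X → a * s + (a + d) * t ≡ n * X →
  n + e ≡ a + (a + d) → X * d ≡ d * t + X * e
scale-equation-above n a d {s} {t} {X} {e} s+t as+bt n+e≡ = +-cancelˡ-≡ (n * X) _ _ (begin
  n * X + X * d                 ≡⟨ cong (_+ X * d) as+bt ⟨
  a * s + (a + d) * t + X * d   ≡⟨ collect a d s t X ⟩
  a * (s + t) + d * t + X * d   ≡⟨ cong (λ k → a * k + d * t + X * d) s+t ⟩
  a * (2 * X) + d * t + X * d   ≡⟨ factor a d t X ⟩
  (a + (a + d)) * X + d * t     ≡⟨ cong (λ k → k * X + d * t) n+e≡ ⟨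
  (n + e) * X + d * t           ≡⟨ expand n e X (d * t) ⟩
  n * X + (d * t + X * e)       ∎)
  where
  collect : ∀ a d s t X → a * s + (a + d) * t + X * d ≡ a * (s + t) + d * t + X * d
  collect = solve-∀
  factor : ∀ a d t X → a * (2 * X) + d * t + X * d ≡ (a + (a + d)) * X + d * t
  factor = solve-∀
  expand : ∀ n e X k → (n + e) * X + k ≡ n * X + (k + X * e)
  expand = solve-∀

-- Here n - 2a = d + e, so dt = (d + e)X and therefore ds = (d - e)X: reversal exchanges the roles
-- of `s` and `t`.
scale-equation-below : ∀ n a d {s t X e} → s + t ≡ 2 * X → a * s + (a + d) * t ≡ n * X →
  a + (a + d) + e ≡ n → X * d ≡ d * s + X * e
scale-equation-below n a d {s} {t} {X} {e} s+t as+bt n≡ = +-cancelʳ-≡ ((a + (a + d)) * X) _ _ (begin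
  X * d + (a + (a + d)) * X     ≡⟨ factor a d X ⟩
  (a + d) * (2 * X)             ≡⟨ cong ((a + d) *_) s+t ⟨
  (a + d) * (s + t)             ≡⟨ collect a d s t ⟩
  d * s + (a * s + (a + d) * t) ≡⟨ cong (d * s +_) as+bt ⟩
  d * s + n * X                 ≡⟨ cong (λ k → d * s + k * X) n≡ ⟨
  d * s + (a + (a + d) + e) * X ≡⟨ expand (a + (a + d)) e X (d * s) ⟩
  d * s + X * e + (a + (a + d)) * X ∎)
  where
  factor : ∀ a d X → X * d + (a + (a + d)) * X ≡ (a + d) * (2 * X)
  factor = solve-∀
  collect : ∀ a d s t → (a + d) * (s + t) ≡ d * s + (a * s + (a + d) * t)
  collect = solve-∀
  expand : ∀ n e X k → k + (n + e) * X ≡ k + X * e + n * X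
  expand = solve-∀

realizable : ∀ m r {n d e} q → 2 ^ m * d ≡ d * q + 2 ^ m * e → r + (r + e) + d ≡ n →
  TwoInDegrees n (r + e) (r + e + d)
realizable m r q eq refl with g , j , α , refl , refl , α≤ ← common-scale m q eq = construction r g j α≤

realizable-above : ∀ m {n} a d {s t} → a + d ≤ n → n ≤ a + (a + d) →
  s + t ≡ 2 * 2 ^ m → a * s + (a + d) * t ≡ n * 2 ^ m → TwoInDegrees n a (a + d)
realizable-above m {n} a d {t = t} b≤n n≤a+b s+t as+bt =
  -- With b = a + d, these are r = n - b and e = a + b - n, whence a = r + e.
  let r , b+r≡n   = m≤n⇒∃[o]m+o≡n b≤n
      e , n+e≡a+b = m≤n⇒∃[o]m+o≡n n≤a+b
      r+e≡a       = +-cancelˡ-≡ (a + d) (r + e) a (begin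
        a + d + (r + e) ≡⟨ +-assoc (a + d) r e ⟨
        a + d + r + e   ≡⟨ cong (_+ e) b+r≡n ⟩
        n + e           ≡⟨ n+e≡a+b ⟩
        a + (a + d)     ≡⟨ +-comm a (a + d) ⟩
        a + d + a       ∎)
      dimension = begin
        r + (r + e) + d ≡⟨ cong (λ k → r + k + d) r+e≡a ⟩
        r + a + d       ≡⟨ +-assoc r a d ⟩
        r + (a + d)     ≡⟨ +-comm r (a + d) ⟩
        a + d + r       ≡⟨ b+r≡n ⟩
        n               ∎
  in subst (λ k → TwoInDegrees n k (k + d)) r+e≡a
       (realizable m r t (scale-equation-above n a d s+t as+bt n+e≡a+b) dimension)

realizable-below : ∀ m {n} a d {s t} → a + (a + d) ≤ n →
  s + t ≡ 2 * 2 ^ m → a * s + (a + d) * t ≡ n * 2 ^ m → TwoInDegrees n a (a + d)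
realizable-below m {n} a d {s} a+b≤n s+t as+bt =
  let e , a+b+e≡n = m≤n⇒∃[o]m+o≡n a+b≤n
  -- Taking `a` for r realizes the in-degrees a + e = n - b and a + e + d = n - a, where b = a + d;
  -- reversal yields b and a, in this order.
  in TwoInDegrees-swap (TwoInDegrees-reverse (trans (low a d e) a+b+e≡n) (trans (high a d e) a+b+e≡n)
       (realizable m a s (scale-equation-below n a d s+t as+bt a+b+e≡n) (trans (reorder a d e) a+b+e≡n)))
  where
  reorder : ∀ a d e → a + (a + e) + d ≡ a + (a + d) + e
  reorder = solve-∀
  low : ∀ a d e → a + e + (a + d) ≡ a + (a + d) + e
  low = solve-∀
  high : ∀ a d e → a + e + d + a ≡ a + (a + d) + e
  high = solve-∀

realizable-≤ : ∀ m {n a b s t} → a ≤ b → b ≤ n →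
  s + t ≡ 2 * 2 ^ m → a * s + b * t ≡ n * 2 ^ m → TwoInDegrees n a b
realizable-≤ m {n} {a} a≤b b≤n s+t as+bt with d , refl ← m≤n⇒∃[o]m+o≡n a≤b with ≤-total n (a + (a + d))
... | inj₁ n≤a+b = realizable-above m a d b≤n n≤a+b s+t as+bt
... | inj₂ a+b≤n = realizable-below m a d a+b≤n s+t as+bt

theorem1 : ∀ (n a b : ℕ) → 1 ≤ n → a ≤ n → b ≤ n →
    (Σ[ o ∈ Orientation n ] ((v : Vertex n) → inDegree o v ≡ a ⊎ inDegree o v ≡ b))
    ⇔ (∃[ s ] ∃[ t ] (s + t ≡ 2 ^ n × a * s + b * t ≡ n * 2 ^ (n ∸ 1)))
theorem1 (suc m) a b _ a≤n b≤n = mk⇔ necessary λ (s , t , s+t , as+bt) → realize s t s+t as+bt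
  where
  necessary : TwoInDegrees (suc m) a b → _
  necessary (o , two) with s , t , s+t , as+bt ← ∑-two-valued (vertices (suc m)) (inDegree o) two =
    s , t , trans s+t (length-vertices (suc m)) , trans as+bt (∑-inDegree o)

  realize : ∀ s t → s + t ≡ 2 ^ suc m → a * s + b * t ≡ suc m * 2 ^ m → TwoInDegrees (suc m) a b
  realize s t s+t as+bt with ≤-total a b
  ... | inj₁ a≤b = realizable-≤ m a≤b b≤n s+t as+bt
  ... | inj₂ b≤a = TwoInDegrees-swap
    (realizable-≤ m b≤a a≤n (trans (+-comm t s) s+t) (trans (+-comm (b * t) (a * s)) as+bt))
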